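{- Let $(H,s,t)$ be a two-rooted graph with $H$ connected and $d_H(s)\le d_H(t)$. If $(H,s,t)$ is inherent, then $(H,s,t)$ is a subcubic two-rooted tree.
   Context: All graphs are finite, simple and undirected. A two-rooted graph is a triple $(H,s,t)$ where $H$ is a graph and $s,t\in V(H)$ are not necessarily distinct; by convention $d_H(s)\le d_H(t)$. A copy of a two-rooted graph $(\hat H,\hat s,\hat t)$ in a graph $G$ is a two-rooted graph $(H,s,t)$ such that $H$ is an induced subgraph of $G$ and some isomorphism $\hat H\to H$ maps $\hat s\mapsto s$, $\hat t\mapsto t$. An extension of a copy $(H,s,t)$ in $G$ is a two-rooted graph $(H',s',t')$ with $H'$ an induced subgraph of $G$, $V(H')=V(H)\cup\{s',t'\}$, $s'\neq t'$, $s',t'\notin V(H)$, $H'-\{s',t'\}=H$, and $s$ (resp. $t$) the unique neighbour of $s'$ (resp. $t'$) in $H'$. The extension is closable if there is an induced $s',t'$-path in $G$ all of whose internal vertices lie outside $N_G[V(H)]$. A copy is avoidable if all its extensions in $G$ are closable. $(\hat H,\hat s,\hat t)$ is inherent if every graph $G$ containing an induced subgraph isomorphic to $\hat H$ also contains an avoidable copy of $(\hat H,\hat s,\hat t)$. A subcubic two-rooted tree is a two-rooted graph $(H,s,t)$ such that either $H$ is a path having $s$ as an endpoint, or $H$ is a tree of maximum degree $3$ with $1=d_H(s)\le d_H(t)\le 2$, where $d_H(t)=1$ if and only if $s=t$. -}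

module Defs where

open import Data.Nat using (ℕ; zero; suc; _≤_; _<_)
open import Data.Fin using (Fin; toℕ; fromℕ)
open import Data.Bool using (Bool; true; false; if_then_else_)
open import Data.List using (List; map; allFin)
open import Data.Nat.ListAction using (sum)
open import Data.Product using (Σ; _×_; _,_)
open import Data.Sum using (_⊎_)
open import Relation.Nullary using (¬_)
open import Relation.Binary.PropositionalEquality using (_≡_; _≢_)
open import Function.Bundles using (_⇔_)
open import Function.Definitions using (Injective)

record Graph : Set where
  field
    n      : ℕ
    E      : Fin n → Fin n → Bool
    symm   : ∀ x y → E x y ≡ E y x
    irrefl : ∀ x → E x x ≡ false
open Graph public

V : Graph → Set
V G = Fin (n G)

Adj : (G : Graph) → V G → V G → Set
Adj G x y = E G x y ≡ true

deg : (G : Graph) → V G → ℕ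
deg G v = sum (map (λ u → if E G v u then 1 else 0) (allFin (n G)))

Consec : ℕ → ℕ → Set
Consec i j = (suc i ≡ j) ⊎ (suc j ≡ i)

data Walk (G : Graph) : V G → V G → Set where
  here : ∀ {x} → Walk G x x
  step : ∀ {x y z} → Adj G x y → Walk G y z → Walk G x z

Connected : Graph → Set
Connected G = ∀ x y → Walk G x y

HasCycle : Graph → Set
HasCycle G = Σ ℕ λ k → Σ (Fin (suc (suc (suc k))) → V G) λ c →
  Injective _≡_ _≡_ c ×
  (∀ i j → Consec (toℕ i) (toℕ j) → Adj G (c i) (c j)) ×
  Adj G (c (fromℕ (suc (suc k)))) (c Data.Fin.zero)

IsTree : Graph → Set
IsTree G = Connected G × ¬ HasCycle G

MaxDeg3 : Graph → Set
MaxDeg3 G = (∀ v → deg G v ≤ 3) × Σ (V G) (λ v → deg G v ≡ 3)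

-- G is a path with s as an endpoint: an ordering p of all vertices with
-- p 0 = s such that two vertices are adjacent iff their positions are consecutive
IsPathWithEnd : (G : Graph) → V G → Set
IsPathWithEnd G s = Σ (V G → V G) λ p →
  Injective _≡_ _≡_ p ×
  (∀ i j → Adj G (p i) (p j) ⇔ Consec (toℕ i) (toℕ j)) ×
  Σ (V G) (λ i → (toℕ i ≡ 0) × (p i ≡ s))

SubcubicTwoRootedTree : (H : Graph) → V H → V H → Set
SubcubicTwoRootedTree H s t =
  IsPathWithEnd H s ⊎
  (IsTree H × MaxDeg3 H × deg H s ≡ 1 × 1 ≤ deg H t × deg H t ≤ 2 ×
   ((deg H t ≡ 1) ⇔ (s ≡ t)))

-- induced embedding of Ĥ into G: an injective map preserving adjacency and
-- non-adjacency. Its image (with roots f ŝ, f t̂) is a copy of (Ĥ, ŝ, t̂).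
record Embedding (Ĥ G : Graph) : Set where
  field
    f      : V Ĥ → V G
    inj    : Injective _≡_ _≡_ f
    induced : ∀ x y → E G (f x) (f y) ≡ E Ĥ x y
open Embedding public

module _ {Ĥ G : Graph} (φ : Embedding Ĥ G) where

  InImage : V G → Set
  InImage v = Σ (V Ĥ) λ x → f φ x ≡ v

  InClosedNbhd : V G → Set
  InClosedNbhd v = Σ (V Ĥ) λ x → (f φ x ≡ v) ⊎ Adj G (f φ x) v

  IsExtension : (ŝ t̂ : V Ĥ) → V G → V G → Set
  IsExtension ŝ t̂ s' t' =
    s' ≢ t' × ¬ InImage s' × ¬ InImage t' ×
    (∀ x → Adj G (f φ x) s' ⇔ (f φ x ≡ f φ ŝ)) ×
    (∀ x → Adj G (f φ x) t' ⇔ (f φ x ≡ f φ t̂)) ×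
    ¬ Adj G s' t'

  Closable : V G → V G → Set
  Closable s' t' = Σ ℕ λ k → Σ (Fin (suc k) → V G) λ p →
    Injective _≡_ _≡_ p ×
    p Data.Fin.zero ≡ s' × p (fromℕ k) ≡ t' ×
    (∀ i j → Adj G (p i) (p j) ⇔ Consec (toℕ i) (toℕ j)) ×
    (∀ i → 0 < toℕ i → toℕ i < k → ¬ InClosedNbhd (p i))

  Avoidable : (ŝ t̂ : V Ĥ) → Set
  Avoidable ŝ t̂ = ∀ s' t' → IsExtension ŝ t̂ s' t' → Closable s' t'

Inherent : (Ĥ : Graph) → V Ĥ → V Ĥ → Set
Inherent Ĥ ŝ t̂ = (G : Graph) → Embedding Ĥ G →
  Σ (Embedding Ĥ G) λ φ → Avoidable φ ŝ t̂

{-# OPTIONS --safe #-}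
-- Plant a tree at every vertex of H: each vertex of H gets |V(H)| + 2 children, and each
-- deeper vertex b children, down to depth |V(H)| + 1.  A child of a copy's root outside the
-- copy starts a branch that can only be left through that root, so two distinct such free
-- children s', t' form an extension that is not closable.  A copy containing a vertex of
-- level 0 reaches only levels below |V(H)| and contains the parents of its vertices of
-- positive level, so a root of degree at most b has a free child, as has a root at level 0.
--   * If H has a cycle, every copy meets level 0, since all cycles of the planted graph lie
--     there; if deg s ≥ 2, the roots of a copy are not leaves of the planted graph.  With
--     b = |V(H)| + 2 both roots have free children.  So H is a tree and deg s ≤ 1.
--   * A vertex of degree at least b + 2 can only be placed at level 0.  Given a vertex of
--     degree at least 3, b = 1 excludes deg t ≥ 3, as well as distinct leaves s, t; then
--     b = 2 excludes degrees above 3.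
-- If there is no vertex of degree 3 or more, H is a path ending at s.
module Submission where

open import Defs
open import Data.Bool using (Bool; true; false; if_then_else_)
import Data.Bool.Properties as Bool
open import Data.Empty using (⊥)
open import Data.Fin as Fin using (Fin; toℕ; fromℕ; inject₁; combine; remQuot)
import Data.Fin.Induction as Fin
import Data.Fin.Properties as Fin
open import Data.List using (List; []; _∷_; _++_; length; map; filter; upTo; allFin; replicate)
open import Data.List.Extrema.Nat using (argmax; f[xs]≤f[argmax])
import Data.List.Membership.DecPropositional as DecMembership
open import Data.List.Membership.Propositional using (_∈_; _∉_; find)
open import Data.List.Membership.Propositional.Properties
open import Data.List.Properties using (length-++; length-map; length-tabulate; length-upTo)
open import Data.List.Relation.Binary.Subset.Propositional using (_⊆_)
open import Data.List.Relation.Unary.All as All using ([]; _∷_)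
open import Data.List.Relation.Unary.Any as Any using (here; there)
open import Data.List.Relation.Unary.Unique.Propositional using (Unique; []; _∷_)
import Data.List.Relation.Unary.Unique.Propositional.Properties as Unique
open import Data.Nat
open import Data.Nat.ListAction using (sum)
open import Data.Nat.Properties
open import Data.Product using (Σ; ∃; _×_; _,_; proj₁; proj₂; map₂)
open import Data.Product.Properties using (,-injectiveˡ; ,-injectiveʳ)
open import Data.Sum using (_⊎_; inj₁; inj₂; swap)
open import Function using (_∘_; id)
open import Function.Bundles using (_⇔_; mk⇔; Equivalence)
open import Relation.Binary.Definitions using (DecidableEquality)
open import Relation.Binary.PropositionalEquality
open import Relation.Nullary using (Dec; does; ¬_; ¬?; yes; no; contradiction)
open import Relation.Nullary.Decidable
  using (_×-dec_; _⊎-dec_; decidable-stable; does-⇔; dec-true; dec-false)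

-- Counting in lists and neighbourhoods

module _ {A : Set} where

  -- Pigeonhole: `x` is cut out of `ys` at one occurrence, and uniqueness keeps the remaining
  -- elements of `xs` inside what is left.
  unique∧⊆⇒length≤ : {xs ys : List A} → Unique xs → xs ⊆ ys → length xs ≤ length ys
  unique∧⊆⇒length≤ [] _ = z≤n
  unique∧⊆⇒length≤ {x ∷ xs} (x∉xs ∷ xs!) xs⊆ys
    with as , bs , refl ← ∈-∃++ (xs⊆ys (here refl)) = begin
    suc (length xs)              ≤⟨ s≤s (unique∧⊆⇒length≤ xs! xs⊆as++bs) ⟩
    suc (length (as ++ bs))      ≡⟨ cong suc (length-++ as) ⟩
    suc (length as + length bs)  ≡⟨ +-suc (length as) (length bs) ⟨
    length as + suc (length bs)  ≡⟨ length-++ as ⟨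
    length (as ++ x ∷ bs)        ∎
    where
    open ≤-Reasoning
    xs⊆as++bs : xs ⊆ as ++ bs
    xs⊆as++bs v∈xs with ∈-++⁻ as (xs⊆ys (there v∈xs))
    ... | inj₁ v∈as         = ∈-++⁺ˡ v∈as
    ... | inj₂ (here refl)  = contradiction refl (All.lookup x∉xs v∈xs)
    ... | inj₂ (there v∈bs) = ∈-++⁺ʳ as v∈bs

  module _ (_≟_ : DecidableEquality A) where
    open DecMembership _≟_ using (_∈?_)

    length<⇒∃∉ : {xs ys : List A} → Unique xs → length ys < length xs →
                 ∃ λ x → x ∈ xs × x ∉ ys
    length<⇒∃∉ {xs} {ys} xs! ys<xs with Any.any? (λ x → ¬? (x ∈? ys)) xs
    ... | yes some = find some
    ... | no none  = contradiction (unique∧⊆⇒length≤ xs! xs⊆ys) (<⇒≱ ys<xs)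
      where
      xs⊆ys : xs ⊆ ys
      xs⊆ys {v} v∈xs = decidable-stable (v ∈? ys) λ v∉ys →
        none (Any.map (λ { refl → v∉ys }) v∈xs)

module _ (H : Graph) where

  neighbours : V H → List (V H)
  neighbours v = filter (λ u → E H v u Bool.≟ true) (allFin (n H))

  neighbours-unique : ∀ v → Unique (neighbours v)
  neighbours-unique v = Unique.filter⁺ (λ u → E H v u Bool.≟ true) (Unique.allFin⁺ (n H))

  ∈-neighbours⁺ : ∀ {v u} → Adj H v u → u ∈ neighbours v
  ∈-neighbours⁺ {v} {u} = ∈-filter⁺ (λ u → E H v u Bool.≟ true) (∈-allFin u)

  ∈-neighbours⁻ : ∀ {v u} → u ∈ neighbours v → Adj H v u
  ∈-neighbours⁻ {v} = proj₂ ∘ ∈-filter⁻ (λ u → E H v u Bool.≟ true) {xs = allFin (n H)}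

  length-neighbours : ∀ v → length (neighbours v) ≡ deg H v
  length-neighbours v = go (allFin (n H))
    where
    go : ∀ us → length (filter (λ u → E H v u Bool.≟ true) us) ≡
                sum (map (λ u → if E H v u then 1 else 0) us)
    go [] = refl
    go (u ∷ us) with E H v u
    ... | true  = cong suc (go us)
    ... | false = go us

  unique-adjacent⇒length≤deg : ∀ {v us} → Unique us → (∀ {u} → u ∈ us → Adj H v u) →
                               length us ≤ deg H v
  unique-adjacent⇒length≤deg {v} us! adj =
    subst (_ ≤_) (length-neighbours v) (unique∧⊆⇒length≤ us! (∈-neighbours⁺ ∘ adj))

  Adj-sym : ∀ {u v} → Adj H u v → Adj H v u
  Adj-sym {u} {v} = trans (symm H v u)

  Adj-irrefl : ∀ {u v} → Adj H u v → u ≢ v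
  Adj-irrefl {u} uv refl with () ← trans (sym uv) (irrefl H u)

  -- The edge is the first step of the walk that leaves `P`.
  leaves-set : ∀ {x y} (P : V H → Set) → (∀ u → Dec (P u)) → Walk H x y → P x → ¬ P y →
               ∃ λ u → ∃ λ w → P u × ¬ P w × Adj H u w
  leaves-set P P? here px ¬py = contradiction px ¬py
  leaves-set P P? (step {y = z} xz w) px ¬py with P? z
  ... | yes pz = leaves-set P P? w pz ¬py
  ... | no ¬pz = _ , _ , px , ¬pz , xz

  connected⇒1≤deg : Connected H → ∀ {x y} → x ≢ y → 1 ≤ deg H x
  connected⇒1≤deg conn {x} {y} x≢y with conn x y
  ... | here = contradiction refl x≢y
  ... | step xz _ = unique-adjacent⇒length≤deg ([] ∷ []) λ { (here refl) → xz }

-- Paths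

Consec-irrefl : ∀ {i} → ¬ Consec i i
Consec-irrefl (inj₁ eq) = 1+n≢n eq
Consec-irrefl (inj₂ eq) = 1+n≢n eq

module _ (H : Graph) (s : V H) (conn : Connected H)
         (deg≤2 : ∀ v → deg H v ≤ 2) (deg-s≤1 : deg H s ≤ 1) where

  open DecMembership (Fin._≟_ {n H}) using (_∈?_)

  -- `p` is total on `ℕ` with only its values below `k` constrained, so that lengthening a path
  -- needs no conversion between `Fin` types.
  record InducedPath (k : ℕ) : Set where
    field
      p         : ℕ → V H
      start     : p 0 ≡ s
      injective : ∀ {i j} → i < k → j < k → p i ≡ p j → i ≡ j
      adj⁺      : ∀ {i j} → i < k → j < k → Consec i j → Adj H (p i) (p j)
      adj⁻      : ∀ {i j} → i < k → j < k → Adj H (p i) (p j) → Consec i j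

  module _ {m : ℕ} (P : InducedPath (suc m)) where
    open InducedPath P

    visited : List (V H)
    visited = map p (upTo (suc m))

    ∈-visited⁺ : ∀ {i} → i < suc m → p i ∈ visited
    ∈-visited⁺ i<1+m = ∈-map⁺ p (∈-upTo⁺ i<1+m)

    -- An inner vertex of the path already has two neighbours on it, and s may have only one.
    only-end-extends : ∀ {j w} → j < suc m → w ∉ visited → Adj H (p j) w → j ≡ m
    only-end-extends {j} {w} j<1+m w∉ pj~w with m<1+n⇒m<n∨m≡n j<1+m
    ... | inj₂ j≡m = j≡m
    ... | inj₁ j<m = contradiction (many-neighbours j j<m pj~w) (<⇒≱ ≤-refl)
      where
      w≢ : ∀ {i} → i < suc m → p i ≢ w
      w≢ i<1+m refl = w∉ (∈-visited⁺ i<1+m)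

      -- Both cases end in the absurd `3 ≤ 2`; at position 0 the violated bound is `2 ≤ 1`, lifted
      -- by `s≤s`.
      many-neighbours : ∀ j → j < m → Adj H (p j) w → 3 ≤ 2
      many-neighbours zero 0<m p0~w =
        s≤s (≤-trans (unique-adjacent⇒length≤deg H ((w≢ (s≤s 0<m) ∷ []) ∷ [] ∷ [])
          λ { (here refl)         → adj⁺ z<s (s≤s 0<m) (inj₁ refl)
            ; (there (here refl)) → p0~w })
          (subst (λ v → deg H v ≤ 1) (sym start) deg-s≤1))
      many-neighbours (suc l) 1+l<m pj~w =
        ≤-trans (unique-adjacent⇒length≤deg H
            (((λ eq → <⇒≢ (m<n⇒m<1+n ≤-refl) (injective l<1+m (s≤s 1+l<m) eq)) ∷ w≢ l<1+m ∷ [])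
            ∷ (w≢ (s≤s 1+l<m) ∷ []) ∷ [] ∷ [])
          λ { (here refl)                 → adj⁺ 1+l<1+m l<1+m (inj₂ refl)
            ; (there (here refl))         → adj⁺ 1+l<1+m (s≤s 1+l<m) (inj₁ refl)
            ; (there (there (here refl))) → pj~w })
          (deg≤2 _)
        where
        1+l<1+m : suc l < suc m
        1+l<1+m = m<n⇒m<1+n 1+l<m
        l<1+m : l < suc m
        l<1+m = <-trans ≤-refl 1+l<1+m

    module _ {w : V H} (w∉ : w ∉ visited) (pm~w : Adj H (p m) w) where

      p′ : ℕ → V H
      p′ i with i ≟ suc m
      ... | yes _ = w
      ... | no _  = p i

      p′-new : p′ (suc m) ≡ w
      p′-new with suc m ≟ suc m
      ... | yes _ = refl
      ... | no ¬eq = contradiction refl ¬eq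

      p′-old : ∀ {i} → i < suc m → p′ i ≡ p i
      p′-old {i} i<1+m with i ≟ suc m
      ... | yes refl = contradiction ≤-refl (<⇒≱ i<1+m)
      ... | no _     = refl

      data View : ℕ → Set where
        old : ∀ {i} → i < suc m → View i
        new : View (suc m)

      view : ∀ {i} → i < suc (suc m) → View i
      view i<2+m with m<1+n⇒m<n∨m≡n i<2+m
      ... | inj₁ i<1+m = old i<1+m
      ... | inj₂ refl  = new

      w≢p : ∀ {i} → i < suc m → w ≢ p i
      w≢p i<1+m refl = w∉ (∈-visited⁺ i<1+m)

      inj′ : ∀ {i j} → View i → View j → p′ i ≡ p′ j → i ≡ j
      inj′ (old i<) (old j<) eq = injective i< j< (trans (sym (p′-old i<)) (trans eq (p′-old j<)))
      inj′ (old i<) new      eq = contradiction (trans (sym p′-new) (trans (sym eq) (p′-old i<))) (w≢p i<)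
      inj′ new      (old j<) eq = contradiction (trans (sym p′-new) (trans eq (p′-old j<))) (w≢p j<)
      inj′ new      new      eq = refl

      new-consec⁺ : ∀ {i} → i < suc m → Consec i (suc m) → Adj H (p i) w
      new-consec⁺ i< (inj₁ refl) = pm~w
      new-consec⁺ i< (inj₂ refl) = contradiction i< (<⇒≱ (m<n⇒m<1+n ≤-refl))

      Consec-sym : ∀ {i j} → Consec i j → Consec j i
      Consec-sym (inj₁ eq) = inj₂ eq
      Consec-sym (inj₂ eq) = inj₁ eq

      adj′⁺ : ∀ {i j} → View i → View j → Consec i j → Adj H (p′ i) (p′ j)
      adj′⁺ (old i<) (old j<) c rewrite p′-old i< | p′-old j< = adj⁺ i< j< c
      adj′⁺ (old i<) new      c rewrite p′-old i< | p′-new    = new-consec⁺ i< c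
      adj′⁺ new      (old j<) c rewrite p′-old j< | p′-new    = Adj-sym H (new-consec⁺ j< (Consec-sym c))
      adj′⁺ new      new      c = contradiction c Consec-irrefl

      -- A chord from `w` to an earlier vertex would contradict `only-end-extends`, so the longer
      -- path is still induced.
      adj′⁻ : ∀ {i j} → View i → View j → Adj H (p′ i) (p′ j) → Consec i j
      adj′⁻ (old i<) (old j<) a rewrite p′-old i< | p′-old j< = adj⁻ i< j< a
      adj′⁻ (old i<) new      a rewrite p′-old i< | p′-new    = inj₁ (cong suc (only-end-extends i< w∉ a))
      adj′⁻ new      (old j<) a rewrite p′-old j< | p′-new    = inj₂ (cong suc (only-end-extends j< w∉ (Adj-sym H a)))
      adj′⁻ new      new      a = contradiction refl (Adj-irrefl H a)

      extend : InducedPath (suc (suc m))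
      extend = record
        { p         = p′
        ; start     = trans (p′-old z<s) start
        ; injective = λ i< j< → inj′ (view i<) (view j<)
        ; adj⁺      = λ i< j< → adj′⁺ (view i<) (view j<)
        ; adj⁻      = λ i< j< → adj′⁻ (view i<) (view j<)
        }

    -- Some vertex is still missing, so by connectivity an edge leaves the visited set, and it can
    -- only start at the end of the path.
    grow : suc m < n H → InducedPath (suc (suc m))
    grow 1+m<n
      with v , _ , v∉ ← length<⇒∃∉ Fin._≟_ {ys = visited} (Unique.allFin⁺ (n H))
        (subst₂ _<_ (sym (trans (length-map p (upTo (suc m))) (length-upTo (suc m))))
                    (sym (length-tabulate {n = n H} id)) 1+m<n)
      with _ , w , u∈ , w∉ , u~w ← leaves-set H (_∈ visited) (_∈? visited) (conn s v)
        (subst (_∈ visited) start (∈-visited⁺ z<s)) v∉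
      with i , i∈ , refl ← ∈-map⁻ p u∈
      with refl ← only-end-extends (∈-upTo⁻ i∈) w∉ u~w
      = extend w∉ u~w

  inducedPath : ∀ m → suc m ≤ n H → InducedPath (suc m)
  inducedPath zero _ = record
    { p         = λ _ → s
    ; start     = refl
    ; injective = λ { z<s z<s _ → refl }
    ; adj⁺      = λ { z<s z<s c → contradiction c Consec-irrefl }
    ; adj⁻      = λ { _ _ a → contradiction refl (Adj-irrefl H a) }
    }
  inducedPath (suc m) m<n = grow (inducedPath m (<⇒≤ m<n)) m<n

  -- The element of `Fin k` shows that `k` is a successor; `s` itself serves as this element for
  -- `k = n H`.
  spanningPath : ∀ {k} → Fin k → k ≤ n H → InducedPath k
  spanningPath {suc m} _ = inducedPath m

  isPathWithEnd : IsPathWithEnd H s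
  isPathWithEnd =
    p ∘ toℕ ,
    (λ {i} {j} eq → Fin.toℕ-injective (injective (Fin.toℕ<n i) (Fin.toℕ<n j) eq)) ,
    (λ i j → mk⇔ (adj⁻ (Fin.toℕ<n i) (Fin.toℕ<n j)) (adj⁺ (Fin.toℕ<n i) (Fin.toℕ<n j))) ,
    Fin.fromℕ< 0<n , Fin.toℕ-fromℕ< 0<n , trans (cong p (Fin.toℕ-fromℕ< 0<n)) start
    where
    open InducedPath (spanningPath s ≤-refl)
    0<n : 0 < n H
    0<n = ≤-<-trans z≤n (Fin.toℕ<n s)

-- Graphs with hanging trees

maximum : ∀ {m} (h : Fin (suc m) → ℕ) → ∃ λ top → ∀ i → h i ≤ h top
maximum {m} h = argmax h Fin.zero (allFin (suc m)) ,
  λ i → All.lookup (f[xs]≤f[argmax] {f = h} Fin.zero (allFin (suc m))) (∈-allFin i)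

-- These are the cyclic predecessor and successor, distinct because a cycle has at least three
-- vertices; the closing edge serves the first and the last position.
cycle-neighbours : (H : Graph) → ((k , c , _) : HasCycle H) → ∀ i →
  ∃ λ a → ∃ λ b → c a ≢ c b × Adj H (c i) (c a) × Adj H (c i) (c b)
cycle-neighbours H (k , c , c-inj , c-adj , c-close) = go
  where
  last : Fin (3 + k)
  last = fromℕ (2 + k)

  distinct : ∀ {a b} → toℕ a ≢ toℕ b → c a ≢ c b
  distinct a≢b = a≢b ∘ cong toℕ ∘ c-inj

  go : ∀ i → ∃ λ a → ∃ λ b → c a ≢ c b × Adj H (c i) (c a) × Adj H (c i) (c b)
  go Fin.zero =
    Fin.suc Fin.zero , last , distinct (λ ()) , c-adj _ _ (inj₁ refl) , Adj-sym H c-close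
  go i@(Fin.suc i₀) with m≤n⇒m<n∨m≡n (Fin.toℕ<n i)
  ... | inj₂ eq = inject₁ i₀ , Fin.zero , distinct prev≢0 ,
      c-adj _ _ (inj₂ (cong suc (Fin.toℕ-inject₁ i₀))) ,
      subst (λ l → Adj H (c l) (c Fin.zero)) last≡i c-close
    where
    last≡i : last ≡ i
    last≡i = Fin.toℕ-injective (trans (Fin.toℕ-fromℕ (2 + k)) (sym (suc-injective eq)))
    prev≢0 : toℕ (inject₁ i₀) ≢ 0
    prev≢0 eq₀ with () ← trans (sym (suc-injective (suc-injective eq)))
                               (trans (sym (Fin.toℕ-inject₁ i₀)) eq₀)
  ... | inj₁ 2+i₀<3+k = inject₁ i₀ , Fin.fromℕ< 2+i₀<3+k ,
      distinct (λ eq → <⇒≢ (m<n⇒m<1+n ≤-refl)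
        (trans (sym (Fin.toℕ-inject₁ i₀)) (trans eq (Fin.toℕ-fromℕ< 2+i₀<3+k)))) ,
      c-adj _ _ (inj₂ (cong suc (Fin.toℕ-inject₁ i₀))) ,
      c-adj _ _ (inj₁ (sym (Fin.toℕ-fromℕ< 2+i₀<3+k)))

-- A graph consisting of an arbitrary graph on the vertices of level 0 with a
-- rooted tree hanging from each of them; _◃_ is the parent-child relation.
record Hanging (G : Graph) (arity : ℕ → ℕ) : Set₁ where
  field
    level           : V G → ℕ
    _◃_             : V G → V G → Set
    ◃⇒adj           : ∀ {u v} → u ◃ v → Adj G u v
    adj-cases       : ∀ {u v} → Adj G u v → (level u ≡ 0 × level v ≡ 0) ⊎ u ◃ v ⊎ v ◃ u
    ◃-level         : ∀ {u v} → u ◃ v → level v ≡ suc (level u)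
    ◃-unique        : ∀ {u u′ v} → u ◃ v → u′ ◃ v → u ≡ u′
    parent          : ∀ {v k} → level v ≡ suc k → ∃ λ u → u ◃ v
    children        : V G → List (V G)
    children-unique : ∀ v → Unique (children v)
    length-children : ∀ v → length (children v) ≡ arity (level v)
    ∈-children⁺     : ∀ {v w} → v ◃ w → w ∈ children v
    ∈-children⁻     : ∀ {v w} → w ∈ children v → v ◃ w

module _ {G : Graph} {arity : ℕ → ℕ} (T : Hanging G arity) where
  open Hanging T

  data Below (v : V G) : V G → Set where
    self  : Below v v
    under : ∀ {u w} → Below v u → u ◃ w → Below v w

  Below⇒level≤ : ∀ {v u} → Below v u → level v ≤ level u
  Below⇒level≤ self        = ≤-refl
  Below⇒level≤ (under b d) = ≤-trans (Below⇒level≤ b) (≤-trans (n≤1+n _) (≤-reflexive (sym (◃-level d))))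

  -- An edge from the branch at `v` leads down or to the unique parent, which is in the branch
  -- unless the edge starts at `v`. Edges within level 0 do not occur, as `v` has positive level.
  Below-exit : ∀ {p v u w} → p ◃ v → Below v u → Adj G u w → Below v w ⊎ (u ≡ v × w ≡ p)
  Below-exit p◃v b u~w with adj-cases u~w
  Below-exit p◃v b u~w           | inj₂ (inj₁ u◃w) = inj₁ (under b u◃w)
  Below-exit p◃v self u~w        | inj₂ (inj₂ w◃u) = inj₂ (refl , ◃-unique w◃u p◃v)
  Below-exit p◃v (under b d) u~w | inj₂ (inj₂ w◃u) = inj₁ (subst (Below _) (◃-unique d w◃u) b)
  Below-exit p◃v b u~w           | inj₁ (u≡0 , _)
    with () ← ≤-trans (≤-reflexive (sym (◃-level p◃v))) (≤-trans (Below⇒level≤ b) (≤-reflexive u≡0))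

  adj⇒level≤ : ∀ {u w} → Adj G u w → level w ≤ suc (level u)
  adj⇒level≤ u~w with adj-cases u~w
  ... | inj₁ (_ , w≡0)   = ≤-trans (≤-reflexive w≡0) z≤n
  ... | inj₂ (inj₁ u◃w)  = ≤-reflexive (◃-level u◃w)
  ... | inj₂ (inj₂ w◃u)  = ≤-trans (n≤1+n _) (≤-trans (≤-reflexive (sym (◃-level w◃u))) (n≤1+n _))

  module _ {H : Graph} (conn : Connected H) (φ : Embedding H G) where

    φ-adj⁺ : ∀ {x y} → Adj H x y → Adj G (f φ x) (f φ y)
    φ-adj⁺ {x} {y} = trans (induced φ x y)

    φ-adj⁻ : ∀ {x y} → Adj G (f φ x) (f φ y) → Adj H x y
    φ-adj⁻ {x} {y} = trans (sym (induced φ x y))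

    FreeChild : V H → V G → Set
    FreeChild x c = f φ x ◃ c × ¬ InImage φ c

    -- The image of a walk from `y` to `x` would have to leave the branch at `c`, since `f φ x` is
    -- one level above `c`. The exit passes through `c`, which is not in the image.
    FreeChild⇒¬Below : ∀ {x c} → FreeChild x c → ∀ y → ¬ Below c (f φ y)
    FreeChild⇒¬Below {x} {c} (φx◃c , c∉) y = go (conn y x)
      where
      go : ∀ {y} → Walk H y x → ¬ Below c (f φ y)
      go here b = 1+n≰n (≤-trans (≤-reflexive (sym (◃-level φx◃c))) (Below⇒level≤ b))
      go (step y~z w) b with Below-exit φx◃c b (φ-adj⁺ y~z)
      ... | inj₁ b′          = go w b′
      ... | inj₂ (refl , _)  = c∉ (_ , refl)

    adj-freeChild : ∀ {r c} → FreeChild r c → ∀ x → Adj G (f φ x) c ⇔ (f φ x ≡ f φ r)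
    adj-freeChild {r} {c} F@(r◃c , c∉) x = mk⇔ to λ eq → subst (λ v → Adj G v c) (sym eq) (◃⇒adj r◃c)
      where
      to : Adj G (f φ x) c → f φ x ≡ f φ r
      to x~c with Below-exit r◃c self (Adj-sym G x~c)
      ... | inj₁ b         = contradiction b (FreeChild⇒¬Below F x)
      ... | inj₂ (_ , eq)  = eq

    module _ {s t : V H} {s′ t′ : V G}
             (s-free : FreeChild s s′) (t-free : FreeChild t t′) (s′≢t′ : s′ ≢ t′) where

      private
        s◃s′ = proj₁ s-free
        t′∉  = proj₂ t-free

      -- Otherwise the parent `f φ t` of `t′` would lie in the branch at `s′`, which contains no
      -- vertex of the copy.
      ¬Below-other : ¬ Below s′ t′
      ¬Below-other self        = s′≢t′ refl
      ¬Below-other (under b d) =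
        FreeChild⇒¬Below s-free t (subst (Below s′) (◃-unique d (proj₁ t-free)) b)

      isExtension : IsExtension φ s t s′ t′
      isExtension = s′≢t′ , proj₂ s-free , t′∉ , adj-freeChild s-free , adj-freeChild t-free , s′≁t′
        where
        s′≁t′ : ¬ Adj G s′ t′
        s′≁t′ s′~t′ with Below-exit s◃s′ self s′~t′
        ... | inj₁ b           = ¬Below-other b
        ... | inj₂ (_ , t′≡s)  = t′∉ (s , sym t′≡s)

      -- A path leaves the branch at s′ only through the root f φ s of the copy.
      ¬closable : ¬ Closable φ s′ t′
      ¬closable (k , p , _ , p0≡s′ , pk≡t′ , p-adj , p-free) =
        ¬Below-other (subst (Below s′) pk≡t′ (p-below (fromℕ k)))
        where
        p-below : ∀ i → Below s′ (p i)
        p-below = Fin.<-weakInduction (Below s′ ∘ p) (subst (Below s′) (sym p0≡s′) self) next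
          where
          next : ∀ i → Below s′ (p (inject₁ i)) → Below s′ (p (Fin.suc i))
          next i b with Below-exit s◃s′ b (Equivalence.from (p-adj (inject₁ i) (Fin.suc i))
                                            (inj₁ (cong suc (Fin.toℕ-inject₁ i))))
          ... | inj₁ b′         = b′
          ... | inj₂ (_ , eq) with m≤n⇒m<n∨m≡n (Fin.toℕ<n i)
          -- The root cannot be an inner vertex of the path, and as its last vertex it would put
          -- `t′` into the image.
          ...   | inj₁ 1+i<k = contradiction (s , inj₁ (sym eq)) (p-free (Fin.suc i) z<s 1+i<k)
          ...   | inj₂ 1+i≡k = contradiction (s , trans (sym eq) (trans (cong p (Fin.toℕ-injective
                                 (trans 1+i≡k (sym (Fin.toℕ-fromℕ k))))) pk≡t′)) t′∉

      freeChildren⇒¬Avoidable : ¬ Avoidable φ s t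
      freeChildren⇒¬Avoidable avoidable = ¬closable (avoidable s′ t′ isExtension)

    -- At a cycle vertex of maximal level, both cycle neighbours would be its parent
    -- if the level were positive.
    cycle⇒level0 : HasCycle H → ∃ λ x → level (f φ x) ≡ 0
    cycle⇒level0 C@(k , c , _) = at-top (maximum height)
      where
      height : Fin (3 + k) → ℕ
      height = level ∘ f φ ∘ c

      at-top : (∃ λ top → ∀ i → height i ≤ height top) → ∃ λ x → level (f φ x) ≡ 0
      at-top (top , top-max) = c top , level≡0 (cycle-neighbours H C top)
        where
        upward : ∀ {a} → Adj H (c top) (c a) → height top ≡ 0 ⊎ f φ (c a) ◃ f φ (c top)
        upward {a} t~a with adj-cases (φ-adj⁺ t~a)
        ... | inj₁ (t≡0 , _)  = inj₁ t≡0
        ... | inj₂ (inj₂ a◃t) = inj₂ a◃t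
        ... | inj₂ (inj₁ t◃a) =
          contradiction (≤-trans (≤-reflexive (sym (◃-level t◃a))) (top-max a)) 1+n≰n

        level≡0 : (∃ λ a → ∃ λ b → c a ≢ c b × Adj H (c top) (c a) × Adj H (c top) (c b)) →
                  height top ≡ 0
        level≡0 (a , b , ca≢cb , t~a , t~b) with upward t~a | upward t~b
        ... | inj₁ t≡0 | _        = t≡0
        ... | inj₂ _   | inj₁ t≡0 = t≡0
        ... | inj₂ a◃t | inj₂ b◃t = contradiction (inj φ (◃-unique a◃t b◃t)) ca≢cb

    -- Every neighbour of `x` is mapped to a child of `f φ x` or to its single parent.
    deg≤1+arity : ∀ {x k} → level (f φ x) ≡ suc k → deg H x ≤ suc (arity (suc k))
    deg≤1+arity {x} {k} eq with q , q◃φx ← parent eq = begin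
      deg H x                                  ≡⟨ length-neighbours H x ⟨
      length (neighbours H x)                  ≡⟨ length-map (f φ) (neighbours H x) ⟨
      length (map (f φ) (neighbours H x))      ≤⟨ unique∧⊆⇒length≤ nbrs-unique ⊆nbhd ⟩
      suc (length (children (f φ x)))          ≡⟨ cong suc (trans (length-children _) (cong arity eq)) ⟩
      suc (arity (suc k))                      ∎
      where
      open ≤-Reasoning
      nbrs-unique : Unique (map (f φ) (neighbours H x))
      nbrs-unique = Unique.map⁺ (inj φ) (neighbours-unique H x)
      ⊆nbhd : map (f φ) (neighbours H x) ⊆ q ∷ children (f φ x)
      ⊆nbhd v∈ with y , y∈ , refl ← ∈-map⁻ (f φ) v∈ with adj-cases (φ-adj⁺ (∈-neighbours⁻ H y∈))
      ... | inj₂ (inj₁ x◃y)  = there (∈-children⁺ x◃y)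
      ... | inj₂ (inj₂ y◃x)  = here (◃-unique y◃x q◃φx)
      ... | inj₁ (x≡0 , _) with () ← trans (sym eq) x≡0

    -- The copy occupies at most `n H` children. The list `avoid` allows a second free child to be
    -- chosen different from a first one.
    freeChild-by-size : ∀ {x} (avoid : List (V G)) → length avoid + n H < arity (level (f φ x)) →
                        ∃ λ c → FreeChild x c × c ∉ avoid
    freeChild-by-size {x} avoid few =
      pick (length<⇒∃∉ Fin._≟_ (children-unique (f φ x))
             (subst₂ _<_ len (sym (length-children (f φ x))) few))
      where
      ys : List (V G)
      ys = avoid ++ map (f φ) (allFin (n H))

      pick : (∃ λ c → c ∈ children (f φ x) × c ∉ ys) → ∃ λ c → FreeChild x c × c ∉ avoid
      pick (c , c∈ , c∉) = c ,
        (∈-children⁻ c∈ , λ { (y , refl) → c∉ (∈-++⁺ʳ avoid (∈-map⁺ (f φ) (∈-allFin y))) }) ,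
        c∉ ∘ ∈-++⁺ˡ

      len : length avoid + n H ≡ length ys
      len = sym (trans (length-++ avoid) (cong (length avoid +_)
              (trans (length-map (f φ) (allFin (n H))) (length-tabulate id))))

    -- Copies that meet level 0

    module _ {x₀ : V H} (φx₀-base : level (f φ x₀) ≡ 0) where

      -- The image of a walk from `y` to `x₀` must leave the branch at `f φ y` to reach level 0, and
      -- the only way out is `p`.
      parent∈image : ∀ {p y} → p ◃ f φ y → InImage φ p
      parent∈image {p} {y} p◃φy = go (conn y x₀) self
        where
        go : ∀ {u} → Walk H u x₀ → Below (f φ y) (f φ u) → InImage φ p
        go here b with () ← ≤-trans (≤-reflexive (sym (◃-level p◃φy)))
                              (≤-trans (Below⇒level≤ b) (≤-reflexive φx₀-base))
        go (step {y = z} u~z w) b with Below-exit p◃φy b (φ-adj⁺ u~z)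
        ... | inj₁ b′        = go w b′
        ... | inj₂ (_ , eq)  = z , eq

      -- Along an edge the level rises by at most one, so no level is skipped.
      intermediate-level : ∀ {y z} → Walk H y z → ∀ {j} → level (f φ y) ≤ j → j ≤ level (f φ z) →
                           ∃ λ x → level (f φ x) ≡ j
      intermediate-level {y} here ≤j j≤ = y , ≤-antisym ≤j j≤
      intermediate-level {y} (step y~u w) ≤j j≤ with m≤n⇒m<n∨m≡n ≤j
      ... | inj₂ eq = y , eq
      ... | inj₁ <j = intermediate-level w (≤-trans (adj⇒level≤ (φ-adj⁺ y~u)) <j) j≤

      -- All levels from 0 to that of `f φ y` occur in the copy, which has only `n H` vertices.
      level<n : ∀ y → level (f φ y) < n H
      level<n y = begin
        suc l                                          ≡⟨ length-upTo (suc l) ⟨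
        length (upTo (suc l))                          ≤⟨ unique∧⊆⇒length≤ (Unique.upTo⁺ (suc l)) ⊆levels ⟩
        length (map (level ∘ f φ) (allFin (n H)))      ≡⟨ length-map (level ∘ f φ) (allFin (n H)) ⟩
        length (allFin (n H))                          ≡⟨ length-tabulate id ⟩
        n H                                            ∎
        where
        open ≤-Reasoning
        l : ℕ
        l = level (f φ y)
        ⊆levels : upTo (suc l) ⊆ map (level ∘ f φ) (allFin (n H))
        ⊆levels j∈
          with x , refl ← intermediate-level (conn x₀ y)
                            (≤-trans (≤-reflexive φx₀-base) z≤n) (s≤s⁻¹ (∈-upTo⁻ j∈))
          = ∈-map⁺ (level ∘ f φ) (∈-allFin x)

      -- The parent of f φ x is the image of a neighbour of x, so fewer than deg x children are.
      freeChild-by-degree : ∀ {x k} (avoid : List (V G)) → level (f φ x) ≡ suc k →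
                            length avoid + deg H x < suc (arity (suc k)) →
                            ∃ λ c → FreeChild x c × c ∉ avoid
      freeChild-by-degree {x} {k} avoid eq few
        with q , q◃φx ← parent eq
        with z , refl ← parent∈image q◃φx
        -- The parent `f φ z` joins the candidates to offset its own occurrence in `ys`; hence the
        -- `suc` in the bound.
        = pick (length<⇒∃∉ Fin._≟_ {ys = ys} (All.tabulate z≢child ∷ children-unique (f φ x))
            (subst₂ _<_ len (cong suc (sym (trans (length-children (f φ x)) (cong arity eq)))) few))
        where
        ys : List (V G)
        ys = avoid ++ map (f φ) (neighbours H x)

        nbr∈ys : ∀ {y} → Adj G (f φ x) (f φ y) → f φ y ∈ ys
        nbr∈ys x~y = ∈-++⁺ʳ avoid (∈-map⁺ (f φ) (∈-neighbours⁺ H (φ-adj⁻ x~y)))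

        len : length avoid + deg H x ≡ length ys
        len = sym (trans (length-++ avoid) (cong (length avoid +_)
                (trans (length-map (f φ) (neighbours H x)) (length-neighbours H x))))

        z≢child : ∀ {c} → c ∈ children (f φ x) → f φ z ≢ c
        z≢child c∈ refl = 1+n≰n (≤-trans (n≤1+n _) (≤-reflexive
          (sym (trans (◃-level (∈-children⁻ c∈)) (cong suc (◃-level q◃φx))))))

        pick : (∃ λ c → c ∈ f φ z ∷ children (f φ x) × c ∉ ys) → ∃ λ c → FreeChild x c × c ∉ avoid
        pick (_ , here refl , c∉) = contradiction (nbr∈ys (Adj-sym G (◃⇒adj q◃φx))) c∉
        pick (c , there c∈ , c∉)  = c ,
          (∈-children⁻ c∈ , λ { (y , refl) → c∉ (nbr∈ys (◃⇒adj (∈-children⁻ c∈))) }) ,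
          c∉ ∘ ∈-++⁺ˡ

      freeChild : ∀ x (avoid : List (V G)) → length avoid + n H < arity 0 →
                  (∀ {k} → k < n H → level (f φ x) ≡ suc k →
                    length avoid + deg H x < suc (arity (suc k))) →
                  ∃ λ c → FreeChild x c × c ∉ avoid
      freeChild x avoid at-base above with level (f φ x) in eq
      ... | zero  = freeChild-by-size avoid (subst (λ l → length avoid + n H < arity l) (sym eq) at-base)
      ... | suc k = freeChild-by-degree avoid eq
                      (above (<-trans ≤-refl (subst (_< n H) eq (level<n x))) refl)

-- Planting trees on a graph

-- Nodes of the rooted tree of height at most length bs in which the nodes at depth i
-- have bs[i] children; a node is given by its path from the root.
infixr 5 _▸_
data Word : List ℕ → Set where
  ε   : ∀ {bs} → Word bs
  _▸_ : ∀ {b bs} → Fin b → Word bs → Word (b ∷ bs)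

data _⋖_ : ∀ {bs} → Word bs → Word bs → Set where
  sprout : ∀ {b bs} {a : Fin b} → ε {b ∷ bs} ⋖ (a ▸ ε)
  deepen : ∀ {b bs} {a : Fin b} {u w : Word bs} → u ⋖ w → (a ▸ u) ⋖ (a ▸ w)

depth : ∀ {bs} → Word bs → ℕ
depth ε       = 0
depth (_ ▸ w) = suc (depth w)

-- The value 0 past the end of the list makes the nodes of full depth leaves.
arity : List ℕ → ℕ → ℕ
arity []       _       = 0
arity (b ∷ _)  zero    = b
arity (_ ∷ bs) (suc k) = arity bs k

size : List ℕ → ℕ
size []       = 1
size (b ∷ bs) = suc (b * size bs)

-- A `Graph` has vertex set `Fin n`, so words are numbered: first the root, then one block for each
-- first letter.
encode : ∀ {bs} → Word bs → Fin (size bs)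
encode {[]}    ε       = Fin.zero
encode {_ ∷ _} ε       = Fin.zero
encode         (a ▸ w) = Fin.suc (combine a (encode w))

decode : ∀ {bs} → Fin (size bs) → Word bs
decode {[]}     _           = ε
decode {b ∷ bs} Fin.zero    = ε
decode {b ∷ bs} (Fin.suc i) =
  proj₁ (remQuot {b} (size bs) i) ▸ decode (proj₂ (remQuot {b} (size bs) i))

decode-encode : ∀ {bs} (w : Word bs) → decode (encode w) ≡ w
decode-encode {[]}    ε = refl
decode-encode {_ ∷ _} ε = refl
decode-encode (a ▸ w) = trans
  (cong (λ q → proj₁ q ▸ decode (proj₂ q)) (Fin.remQuot-combine a (encode w)))
  (cong (a ▸_) (decode-encode w))

encode-decode : ∀ {bs} (i : Fin (size bs)) → encode (decode {bs} i) ≡ i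
encode-decode {[]}     Fin.zero    = refl
encode-decode {b ∷ bs} Fin.zero    = refl
encode-decode {b ∷ bs} (Fin.suc i) = cong Fin.suc (trans
  (cong (combine (proj₁ (remQuot {b} (size bs) i))) (encode-decode {bs} _))
  (Fin.combine-remQuot {b} (size bs) i))

ε? : ∀ {bs} (w : Word bs) → Dec (w ≡ ε)
ε? ε       = yes refl
ε? (_ ▸ _) = no λ ()

_⋖?_ : ∀ {bs} (u w : Word bs) → Dec (u ⋖ w)
ε       ⋖? ε           = no λ ()
ε       ⋖? (_ ▸ ε)     = yes sprout
ε       ⋖? (_ ▸ _ ▸ _) = no λ ()
(_ ▸ _) ⋖? ε           = no λ ()
(a ▸ u) ⋖? (b ▸ w) with a Fin.≟ b | u ⋖? w
... | yes refl | yes u⋖w = yes (deepen u⋖w)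
... | yes _    | no ¬u⋖w = no λ { (deepen u⋖w) → ¬u⋖w u⋖w }
... | no a≢b   | _       = no λ { (deepen _) → a≢b refl }

⋖-depth : ∀ {bs} {u w : Word bs} → u ⋖ w → depth w ≡ suc (depth u)
⋖-depth sprout     = refl
⋖-depth (deepen d) = cong suc (⋖-depth d)

⋖-unique : ∀ {bs} {u u′ w : Word bs} → u ⋖ w → u′ ⋖ w → u ≡ u′
⋖-unique sprout     sprout      = refl
⋖-unique (deepen d) (deepen d′) = cong (_ ▸_) (⋖-unique d d′)

⋖-parent : ∀ {bs} (w : Word bs) {k} → depth w ≡ suc k → ∃ λ u → u ⋖ w
⋖-parent (a ▸ ε)     _ = ε , sprout
⋖-parent (a ▸ b ▸ w) _ with u , d ← ⋖-parent (b ▸ w) refl = a ▸ u , deepen d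

successors : ∀ {bs} → Word bs → List (Word bs)
successors {[]}    ε       = []
successors {b ∷ _} ε       = map (_▸ ε) (allFin b)
successors         (a ▸ w) = map (a ▸_) (successors w)

▸-injectiveˡ : ∀ {b bs} {a a′ : Fin b} {u w : Word bs} → a ▸ u ≡ a′ ▸ w → a ≡ a′
▸-injectiveˡ refl = refl

▸-injectiveʳ : ∀ {b bs} {a a′ : Fin b} {u w : Word bs} → a ▸ u ≡ a′ ▸ w → u ≡ w
▸-injectiveʳ refl = refl

successors-unique : ∀ {bs} (w : Word bs) → Unique (successors w)
successors-unique {[]}    ε       = []
successors-unique {b ∷ _} ε       = Unique.map⁺ ▸-injectiveˡ (Unique.allFin⁺ b)
successors-unique         (a ▸ w) = Unique.map⁺ ▸-injectiveʳ (successors-unique w)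

length-successors : ∀ {bs} (w : Word bs) → length (successors w) ≡ arity bs (depth w)
length-successors {[]}    ε       = refl
length-successors {b ∷ _} ε       = trans (length-map _ (allFin b)) (length-tabulate {n = b} id)
length-successors         (a ▸ w) = trans (length-map (a ▸_) (successors w)) (length-successors w)

∈-successors⁺ : ∀ {bs} {u w : Word bs} → u ⋖ w → w ∈ successors u
∈-successors⁺ sprout     = ∈-map⁺ (_▸ ε) (∈-allFin _)
∈-successors⁺ (deepen d) = ∈-map⁺ (_ ▸_) (∈-successors⁺ d)

∈-successors⁻ : ∀ {bs} (u : Word bs) {w} → w ∈ successors u → u ⋖ w
∈-successors⁻ {_ ∷ _} ε       w∈ with _ , _ , refl ← ∈-map⁻ (_▸ ε) w∈     = sprout
∈-successors⁻         (a ▸ u) w∈ with _ , v∈ , refl ← ∈-map⁻ (a ▸_) w∈ = deepen (∈-successors⁻ u v∈)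

does⇒ : {A : Set} (a? : Dec A) → does a? ≡ true → A
does⇒ (yes a) _ = a

module _ (H : Graph) (bs : List ℕ) where

  Node : Set
  Node = V H × Word bs

  node : Fin (n H * size bs) → Node
  node = map₂ (decode {bs}) ∘ remQuot {n H} (size bs)

  code : Node → Fin (n H * size bs)
  code (x , w) = combine x (encode w)

  node-code : ∀ p → node (code p) ≡ p
  node-code (x , w) = trans (cong (map₂ (decode {bs})) (Fin.remQuot-combine x (encode w)))
                            (cong (x ,_) (decode-encode w))

  code-node : ∀ i → code (node i) ≡ i
  code-node i = trans (cong (combine (proj₁ (remQuot {n H} (size bs) i))) (encode-decode {bs} _))
                      (Fin.combine-remQuot {n H} (size bs) i)

  BaseEdge : Node → Node → Set
  BaseEdge (x , u) (y , w) = u ≡ ε × w ≡ ε × Adj H x y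

  _⋖ⁿ_ : Node → Node → Set
  (x , u) ⋖ⁿ (y , w) = x ≡ y × u ⋖ w

  Edge : Node → Node → Set
  Edge p q = BaseEdge p q ⊎ p ⋖ⁿ q ⊎ q ⋖ⁿ p

  _⋖ⁿ?_ : ∀ p q → Dec (p ⋖ⁿ q)
  (x , u) ⋖ⁿ? (y , w) = (x Fin.≟ y) ×-dec (u ⋖? w)

  Edge? : ∀ p q → Dec (Edge p q)
  Edge? p@(x , u) q@(y , w) =
    (ε? u ×-dec (ε? w ×-dec (E H x y Bool.≟ true))) ⊎-dec ((p ⋖ⁿ? q) ⊎-dec (q ⋖ⁿ? p))

  Edge-sym : ∀ {p q} → Edge p q → Edge q p
  Edge-sym (inj₁ (u≡ε , w≡ε , xy)) = inj₁ (w≡ε , u≡ε , Adj-sym H xy)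
  Edge-sym (inj₂ d)                = inj₂ (swap d)

  Edge-irrefl : ∀ {p} → ¬ Edge p p
  Edge-irrefl (inj₁ (_ , _ , xx))   = Adj-irrefl H xx refl
  Edge-irrefl (inj₂ (inj₁ (_ , d))) = 1+n≢n (sym (⋖-depth d))
  Edge-irrefl (inj₂ (inj₂ (_ , d))) = 1+n≢n (sym (⋖-depth d))

  plant : Graph
  plant = record
    { n      = n H * size bs
    ; E      = λ i j → does (Edge? (node i) (node j))
    ; symm   = λ i j → does-⇔ (mk⇔ Edge-sym Edge-sym)
                         (Edge? (node i) (node j)) (Edge? (node j) (node i))
    ; irrefl = λ i → dec-false (Edge? (node i) (node i)) Edge-irrefl
    }

  Adj⇒Edge : ∀ i j → Adj plant i j → Edge (node i) (node j)
  Adj⇒Edge i j = does⇒ (Edge? (node i) (node j))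

  planted : Hanging plant (arity bs)
  planted = record
    { level           = depth ∘ proj₂ ∘ node
    ; _◃_             = λ i j → node i ⋖ⁿ node j
    ; ◃⇒adj           = λ {i} {j} d → dec-true (Edge? (node i) (node j)) (inj₂ (inj₁ d))
    ; adj-cases       = λ {i} {j} → cases ∘ Adj⇒Edge i j
    ; ◃-level         = ⋖-depth ∘ proj₂
    ; ◃-unique        = λ {i} {i′} d d′ → node-injective (unique d d′)
    ; parent          = λ {i} eq → let u , d = ⋖-parent (proj₂ (node i)) eq in
                          code (proj₁ (node i) , u) ,
                          subst (_⋖ⁿ node i) (sym (node-code _)) (refl , d)
    ; children        = λ i → map (code ∘ (proj₁ (node i) ,_)) (successors (proj₂ (node i)))
    ; children-unique = λ i → Unique.map⁺ (,-injectiveʳ ∘ code-injective)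
                          (successors-unique (proj₂ (node i)))
    ; length-children = λ i → trans (length-map _ (successors (proj₂ (node i))))
                          (length-successors (proj₂ (node i)))
    ; ∈-children⁺     = λ {i} {j} → child⁺ i j
    ; ∈-children⁻     = λ {i} → child⁻ i
    }
    where
    cases : ∀ {p q} → Edge p q → (depth (proj₂ p) ≡ 0 × depth (proj₂ q) ≡ 0) ⊎ p ⋖ⁿ q ⊎ q ⋖ⁿ p
    cases (inj₁ (refl , refl , _)) = inj₁ (refl , refl)
    cases (inj₂ d)                 = inj₂ d

    node-injective : ∀ {i j} → node i ≡ node j → i ≡ j
    node-injective {i} {j} eq = trans (sym (code-node i)) (trans (cong code eq) (code-node j))

    code-injective : ∀ {p q} → code p ≡ code q → p ≡ q
    code-injective {p} {q} eq = trans (sym (node-code p)) (trans (cong node eq) (node-code q))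

    unique : ∀ {p p′ q} → p ⋖ⁿ q → p′ ⋖ⁿ q → p ≡ p′
    unique (refl , d) (refl , d′) = cong (_ ,_) (⋖-unique d d′)

    child⁺ : ∀ i j → node i ⋖ⁿ node j →
             j ∈ map (code ∘ (proj₁ (node i) ,_)) (successors (proj₂ (node i)))
    child⁺ i j (x≡y , d) = subst (_∈ _)
      (trans (cong (λ x → code (x , proj₂ (node j))) x≡y) (code-node j))
      (∈-map⁺ (code ∘ (proj₁ (node i) ,_)) (∈-successors⁺ d))

    child⁻ : ∀ i {j} → j ∈ map (code ∘ (proj₁ (node i) ,_)) (successors (proj₂ (node i))) →
             node i ⋖ⁿ node j
    child⁻ i j∈ with w , w∈ , refl ← ∈-map⁻ (code ∘ (proj₁ (node i) ,_)) j∈ =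
      subst (node i ⋖ⁿ_) (sym (node-code _)) (refl , ∈-successors⁻ _ w∈)

  -- The copy on level 0 makes `Inherent` applicable to `plant`.
  base : Embedding H plant
  base = record
    { f       = λ x → code (x , ε)
    ; inj     = λ {x} {y} eq → ,-injectiveˡ
        (trans (sym (node-code (x , ε))) (trans (cong node eq) (node-code (y , ε))))
    ; induced = λ x y → trans
        (cong₂ (λ p q → does (Edge? p q)) (node-code (x , ε)) (node-code (y , ε)))
        (trans (does-⇔ (mk⇔ from (λ xy → inj₁ (refl , refl , xy)))
                 (Edge? (x , ε) (y , ε)) (E H x y Bool.≟ true))
               (does-≟true (E H x y)))
    }
    where
    from : ∀ {x y} → Edge (x , ε) (y , ε) → Adj H x y
    from (inj₁ (_ , _ , xy)) = xy
    from (inj₂ (inj₁ (_ , ())))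
    from (inj₂ (inj₂ (_ , ())))

    does-≟true : ∀ b → does (b Bool.≟ true) ≡ b
    does-≟true true  = refl
    does-≟true false = refl

-- Inherent two-rooted graphs

arity-replicate : ∀ {m b k} → k < m → arity (replicate m b) k ≡ b
arity-replicate {suc _} {k = zero}  _         = refl
arity-replicate {suc _} {k = suc _} (s≤s k<m) = arity-replicate k<m

arity-replicate-cases : ∀ m b k → arity (replicate m b) k ≡ 0 ⊎ arity (replicate m b) k ≡ b
arity-replicate-cases zero    b k       = inj₁ refl
arity-replicate-cases (suc m) b zero    = inj₂ refl
arity-replicate-cases (suc m) b (suc k) = arity-replicate-cases m b k

arity-replicate≤ : ∀ m b k → arity (replicate m b) k ≤ b
arity-replicate≤ m b k with arity-replicate-cases m b k
... | inj₁ eq = ≤-trans (≤-reflexive eq) z≤n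
... | inj₂ eq = ≤-reflexive eq

module _ {H : Graph} {s t : V H} (conn : Connected H) (inherent : Inherent H s t) where

  module Host (b : ℕ) where

    -- A vertex of level 0 has two children outside any copy. For positive `b` the leaves have level
    -- `1 + n H`, out of reach for a copy that meets level 0.
    widths : List ℕ
    widths = 2 + n H ∷ replicate (n H) b

    G : Graph
    G = plant H widths

    tree : Hanging G (arity widths)
    tree = planted H widths

    open Hanging tree public using (level; ◃-unique)

    copy : Σ (Embedding H G) λ φ → Avoidable φ s t
    copy = inherent G (base H widths)

    φ : Embedding H G
    φ = proj₁ copy

    clash : ∀ {s′ t′} → FreeChild tree conn φ s s′ → FreeChild tree conn φ t t′ → ¬ (s′ ≢ t′)
    clash s-free t-free s′≢t′ = freeChildren⇒¬Avoidable tree conn φ s-free t-free s′≢t′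
      (proj₂ copy)

    deg≥⇒level0 : ∀ {x} → 2 + b ≤ deg H x → level (f φ x) ≡ 0
    deg≥⇒level0 {x} 2+b≤deg with level (f φ x) in eq
    ... | zero  = refl
    ... | suc k = contradiction
      (≤-trans 2+b≤deg (≤-trans (deg≤1+arity tree conn φ eq) (s≤s (arity-replicate≤ (n H) b k))))
      1+n≰n

    module _ {x₀ : V H} (2+b≤deg : 2 + b ≤ deg H x₀) where

      -- The vertex `x₀` pins the copy to level 0. A small degree of `x` leaves a child free at any
      -- level; a large one forces `x` onto level 0, where there are children enough.
      freeChild-avoiding : ∀ x (avoid : List (V G)) → length avoid ≤ 1 →
                           length avoid + deg H x ≤ b ⊎ 2 + b ≤ deg H x →
                           ∃ λ c → FreeChild tree conn φ x c × c ∉ avoid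
      freeChild-avoiding x avoid ≤1 x-deg =
        freeChild tree conn φ (deg≥⇒level0 2+b≤deg) x avoid (s≤s (+-monoˡ-≤ (n H) ≤1)) (above x-deg)
        where
        above : length avoid + deg H x ≤ b ⊎ 2 + b ≤ deg H x →
                ∀ {k} → k < n H → level (f φ x) ≡ suc k →
                length avoid + deg H x < suc (arity (replicate (n H) b) k)
        above (inj₁ few)  k<n _  = s≤s (≤-trans few (≤-reflexive (sym (arity-replicate k<n))))
        above (inj₂ many) _   eq with () ← trans (sym eq) (deg≥⇒level0 many)

      -- Parents are unique, so children of different roots differ automatically.
      distinct-roots : s ≢ t → deg H s ≤ b ⊎ 2 + b ≤ deg H s → deg H t ≤ b ⊎ 2 + b ≤ deg H t → ⊥
      distinct-roots s≢t s-deg t-deg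
        with s′ , s-free , _ ← freeChild-avoiding s [] z≤n s-deg
        with t′ , t-free , _ ← freeChild-avoiding t [] z≤n t-deg
        = clash s-free t-free λ { refl → s≢t (inj φ (◃-unique (proj₁ s-free) (proj₁ t-free))) }

      -- Both free children hang from one vertex; the strict bound makes room for the second.
      equal-roots : s ≡ t → deg H s < b → ⊥
      equal-roots refl deg<b
        with s′ , s-free , _  ← freeChild-avoiding s [] z≤n (inj₁ (<⇒≤ deg<b))
        with t′ , t-free , t′∉ ← freeChild-avoiding s (s′ ∷ []) ≤-refl (inj₁ deg<b)
        = clash s-free t-free λ { refl → t′∉ (here refl) }

  -- With this `b` every vertex except the leaves of the planted trees has `2 + n H` children,
  -- enough for two free ones even if the roots coincide.
  open Host (2 + n H)

  private
    wide-roots : (∀ {x} → x ≡ s ⊎ x ≡ t → arity widths (level (f φ x)) ≡ 2 + n H) → ⊥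
    wide-roots wide
      with s′ , s-free , _ ← freeChild-by-size tree conn φ []
             (subst (n H <_) (sym (wide (inj₁ refl))) (m<n⇒m<1+n ≤-refl))
      with t′ , t-free , t′∉ ← freeChild-by-size tree conn φ (s′ ∷ [])
             (subst (1 + n H <_) (sym (wide (inj₂ refl))) ≤-refl)
      = clash s-free t-free λ { refl → t′∉ (here refl) }

    -- At positive level, arity 0 would leave the parent as the only possible neighbour.
    positive-arity : ∀ {x} → 2 ≤ deg H x → arity widths (level (f φ x)) ≡ 2 + n H
    positive-arity {x} 2≤deg with level (f φ x) in eq
    ... | zero  = refl
    ... | suc k with arity-replicate-cases (n H) (2 + n H) k
    ...   | inj₂ full = full
    ...   | inj₁ none = contradiction
      (≤-trans 2≤deg (≤-trans (deg≤1+arity tree conn φ eq) (s≤s (≤-reflexive none)))) 1+n≰n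

    shallow-arity : ∀ {l} → l < n H → arity widths l ≡ 2 + n H
    shallow-arity {zero}  _     = refl
    shallow-arity {suc k} 1+k<n = arity-replicate (<-trans ≤-refl 1+k<n)

  inherent⇒acyclic : ¬ HasCycle H
  inherent⇒acyclic cycle =
    wide-roots λ {x} _ → shallow-arity (level<n tree conn φ (proj₂ (cycle⇒level0 tree conn φ cycle)) x)

  inherent⇒leaf : deg H s ≤ deg H t → deg H s ≤ 1
  inherent⇒leaf s≤t = decidable-stable (deg H s ≤? 1) λ s≰1 →
    wide-roots λ { (inj₁ refl) → positive-arity (≰⇒> s≰1)
                 ; (inj₂ refl) → positive-arity (≤-trans (≰⇒> s≰1) s≤t) }

theorem1p6 : (H : Graph) (s t : V H) → Connected H → deg H s ≤ deg H t →
    Inherent H s t → SubcubicTwoRootedTree H s t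
theorem1p6 H s t conn s≤t inherent with Fin.any? (λ v → 3 ≤? deg H v)
... | no none = inj₁ (isPathWithEnd H s conn
        (λ v → s≤s⁻¹ (≰⇒> λ 3≤v → none (v , 3≤v))) (inherent⇒leaf conn inherent s≤t))
... | yes (x₀ , 3≤x₀) = inj₂
        ((conn , inherent⇒acyclic conn inherent) , (deg≤3 , x₀ , ≤-antisym (deg≤3 x₀) 3≤x₀) ,
         deg-s≡1 , ≤-trans 1≤deg-s s≤t , deg-t≤2 , mk⇔ t-leaf⇒s≡t λ { refl → deg-s≡1 })
  where
  open Host conn inherent

  deg-s≤1 : deg H s ≤ 1
  deg-s≤1 = inherent⇒leaf conn inherent s≤t

  s≢deg≥3 : ∀ {x} → 3 ≤ deg H x → s ≢ x
  s≢deg≥3 3≤x refl = contradiction (≤-trans 3≤x deg-s≤1) λ { (s≤s ()) }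

  1≤deg-s : 1 ≤ deg H s
  1≤deg-s = connected⇒1≤deg H conn (s≢deg≥3 3≤x₀)

  deg-s≡1 : deg H s ≡ 1
  deg-s≡1 = ≤-antisym deg-s≤1 1≤deg-s

  deg-t≤2 : deg H t ≤ 2
  deg-t≤2 = s≤s⁻¹ (≰⇒> λ 3≤t →
    -- For `b = 1` the threshold `2 + b` is 3, so `x₀` and `t` are both on level 0, while `s` has
    -- degree at most `b`.
    distinct-roots 1 3≤x₀ (s≢deg≥3 3≤t) (inj₁ deg-s≤1) (inj₂ 3≤t))

  t-leaf⇒s≡t : deg H t ≡ 1 → s ≡ t
  t-leaf⇒s≡t deg-t≡1 = decidable-stable (s Fin.≟ t) λ s≢t →
    distinct-roots 1 3≤x₀ s≢t (inj₁ deg-s≤1) (inj₁ (≤-reflexive deg-t≡1))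

  deg≤3 : ∀ v → deg H v ≤ 3
  deg≤3 v = s≤s⁻¹ (≰⇒> refute)
    where
    refute : ¬ 4 ≤ deg H v
    refute 4≤v with s Fin.≟ t
    -- For `b = 2` the vertex `v` reaches the threshold 4. If the roots coincide, their degree 1 is
    -- strictly below `b`; otherwise both degrees are at most `b`.
    ... | yes s≡t = equal-roots 2 4≤v s≡t (s≤s deg-s≤1)
    ... | no s≢t  = distinct-roots 2 4≤v s≢t (inj₁ (m≤n⇒m≤1+n deg-s≤1)) (inj₁ deg-t≤2)
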